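{- Let $\Omega_n^{\{1,3\}}(\tau)$ denote the set of permutations $\pi\in S_n$ that avoid $\tau$ and whose order in the group $S_n$ is $1$ or $3$. Then \[\sum_{n\ge1}\big|\Omega_n^{\{1,3\}}(231)\big|x^n=\sum_{n\ge1}\big|\Omega_n^{\{1,3\}}(312)\big|x^n=\frac{x+x^3+x^5}{1-x-3x^3-x^5}.\]
   Context: Permutations $\pi\in S_n$ are identified with words $\pi(1)\cdots\pi(n)$. For $\tau\in S_m$, entries $\pi(i_1),\ldots,\pi(i_m)$ with $i_1<\cdots<i_m$ form an occurrence of $\tau$ if for all $j,l$, $\pi(i_j)<\pi(i_l)$ iff $\tau(j)<\tau(l)$; $\pi$ avoids $\tau$ if there is no occurrence. -}

module Defs where

open import Data.Nat as ℕ using (ℕ; zero; suc; _∸_; _≤_)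
open import Data.Fin as Fin using (Fin; _<_)
open import Data.Fin.Properties using ()
open import Data.Vec using (Vec; lookup; tabulate; allFin; _∷_; [])
open import Data.List using (List; length; map; upTo)
open import Data.List.Membership.Propositional using (_∈_)
open import Data.List.Relation.Unary.Unique.Propositional using (Unique)
open import Data.Integer as ℤ using (ℤ; +_; -_)
open import Data.Product using (Σ; _×_; ∃)
open import Data.Sum using (_⊎_)
open import Relation.Binary.PropositionalEquality using (_≡_; _≢_)
open import Relation.Nullary using (¬_)
open import Function.Bundles using (_⇔_)
open import Function.Definitions using (Injective)

-- Permutations of [n] = {0,…,n-1} as words π(1)⋯π(n) (0-indexed values)

Word : ℕ → Set
Word n = Vec (Fin n) n

-- a word is a permutation iff i ↦ π(i) is injective (hence bijective)
IsPerm : ∀ {n} → Word n → Set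
IsPerm {n} π = Injective _≡_ _≡_ (lookup π)

idPerm : ∀ n → Word n
idPerm n = allFin n

_⊚_ : ∀ {n} → Word n → Word n → Word n
π ⊚ σ = tabulate (λ i → lookup π (lookup σ i))

_^ᵖ_ : ∀ {n} → Word n → ℕ → Word n
_^ᵖ_ {n} π zero    = idPerm n
_^ᵖ_ {n} π (suc k) = π ⊚ (π ^ᵖ k)

HasOrder : ∀ {n} → Word n → ℕ → Set
HasOrder {n} π k =
  1 ≤ k × (π ^ᵖ k) ≡ idPerm n × (∀ j → 1 ≤ j → j ℕ.< k → (π ^ᵖ j) ≢ idPerm n)

StrictlyIncreasing : ∀ {m n} → (Fin m → Fin n) → Set
StrictlyIncreasing {m} ι = ∀ (j l : Fin m) → j < l → ι j < ι l

Occurs : ∀ {m n} → Word m → Word n → Set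
Occurs {m} {n} τ π =
  Σ (Fin m → Fin n) λ ι → StrictlyIncreasing ι ×
    (∀ (j l : Fin m) → (lookup π (ι j) < lookup π (ι l)) ⇔ (lookup τ j < lookup τ l))

Avoids : ∀ {m n} → Word n → Word m → Set
Avoids π τ = ¬ Occurs τ π

-- the patterns 231 and 312 (values shifted down by one)
p231 : Word 3
p231 = Fin.suc Fin.zero ∷ Fin.suc (Fin.suc Fin.zero) ∷ Fin.zero ∷ []

p312 : Word 3
p312 = Fin.suc (Fin.suc Fin.zero) ∷ Fin.zero ∷ Fin.suc Fin.zero ∷ []

InΩ13 : ∀ {m} → Word m → (n : ℕ) → Word n → Set
InΩ13 τ n π = IsPerm π × Avoids π τ × (HasOrder π 1 ⊎ HasOrder π 3)

HasCard : {A : Set} → (A → Set) → ℕ → Set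
HasCard {A} P c =
  Σ (List A) λ l → Unique l × length l ≡ c × (∀ x → (x ∈ l) ⇔ P x)

Series : Set
Series = ℕ → ℤ

sumℤ : List ℤ → ℤ
sumℤ = Data.List.foldr ℤ._+_ (+ 0)

_·ˢ_ : Series → Series → Series
(f ·ˢ g) n = sumℤ (map (λ k → f k ℤ.* g (n ∸ k)) (upTo (suc n)))

numer : Series
numer 1 = + 1
numer 3 = + 1
numer 5 = + 1
numer _ = + 0

denom : Series
denom 0 = + 1
denom 1 = - (+ 1)
denom 3 = - (+ 3)
denom 5 = - (+ 1)
denom _ = + 0

-- Σ_{n≥1} a_n x^n = numer / denom, i.e. (since denom has constant term 1,
-- so is invertible in ℤ[[x]]) denom · A = numer, with a_0 = 0.
GFIs : (ℕ → ℕ) → Set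
GFIs a = a 0 ≡ 0 × (∀ n → (denom ·ˢ (λ k → + a k)) n ≡ numer n)

CountGF : ∀ {m} → Word m → Set
CountGF τ =
  Σ (ℕ → ℕ) λ a → (∀ n → HasCard (InΩ13 τ (suc n)) (a (suc n))) × GFIs a

{-# OPTIONS --safe #-}
module Submission where

-- Let π avoid 231 with π³ = 1.  Either π fixes the first point, or the first point lies
-- on a 3-cycle 0 ↦ K ↦ C ↦ 0 with 0 < C < K, where π preserves [0,K].  Deleting this cycle
-- leaves a permutation σ of the same kind which, below K, is decreasing on the places
-- before C and takes the values above C in decreasing order.  Together with σ³ = 1 this
-- leaves only: the block is 312; the block is 52143; or the deleted cycle was obtained by
-- doubling the points of the σ-cycle of 0, the new copy of σ(σ(0)) coming directly before
-- or directly after the old one.  Hence a(n) = a(n-1) + 3 a(n-3) + a(n-5), up to the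
-- initial terms 1, 312 and 52143.  For 312 pass to inverses.

open import Defs
open import Data.Empty using (⊥; ⊥-elim)
open import Data.Fin as Fin using (Fin; toℕ; fromℕ<)
open import Data.Fin.Patterns using (0F; 1F; 2F)
open import Data.Fin.Properties as Finₚ using (toℕ-injective; toℕ<n; toℕ-fromℕ<; fromℕ<-toℕ)
open import Data.Integer as ℤ using (ℤ; +_; -_)
open import Data.Integer.Tactic.RingSolver using (solve-∀)
open import Data.List using (List; []; _∷_; _++_; map; length; applyUpTo)
open import Data.List.Membership.Propositional using (_∈_)
open import Data.List.Membership.Propositional.Properties using (∈-map⁺; ∈-map⁻; ∈-++⁺ˡ; ∈-++⁺ʳ)
open import Data.List.Properties using (length-map; length-++)
open import Data.List.Relation.Unary.All as All using (All; []; _∷_)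
open import Data.List.Relation.Unary.All.Properties as All using ()
open import Data.List.Relation.Unary.AllPairs using ([]; _∷_)
open import Data.List.Relation.Unary.Any using (here)
open import Data.List.Relation.Unary.Unique.Propositional using (Unique)
open import Data.List.Relation.Unary.Unique.Propositional.Properties as Unique using ()
open import Data.Maybe as Maybe using (Maybe; just; nothing; maybe′)
open import Data.Nat using (ℕ; zero; suc; _+_; _∸_; _≤_; _<_; z≤n; s≤s; z<s; s<s; s≤s⁻¹; s<s⁻¹; _≤?_; _<?_; _≟_; pred)
open import Data.Nat.Induction using (<-rec)
open import Data.Nat.Properties
open import Data.Product using (∃; _×_; _,_; proj₁; proj₂)
open import Data.Sum as Sum using (_⊎_; inj₁; inj₂)
open import Data.Vec using (lookup; tabulate; []; _∷_)
open import Data.Vec.Properties using (≡-dec; lookup∘tabulate; tabulate∘lookup; tabulate-cong; lookup-allFin)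
open import Function using (_∘_; id)
open import Function.Bundles using (mk⇔; Equivalence)
open import Function.Definitions using (Injective)
open import Relation.Binary.Definitions using (tri<; tri≈; tri>)
open import Relation.Binary.PropositionalEquality
open import Relation.Nullary using (¬_; yes; no; contradiction)

-- Inserting a point into ℕ

punch : ℕ → ℕ → ℕ
punch zero    x       = suc x
punch (suc p) zero    = zero
punch (suc p) (suc x) = suc (punch p x)

unpunch : ℕ → ℕ → Maybe ℕ
unpunch zero    zero    = nothing
unpunch zero    (suc x) = just x
unpunch (suc p) zero    = just zero
unpunch (suc p) (suc x) = Maybe.map suc (unpunch p x)

unpunch-self : ∀ p → unpunch p p ≡ nothing
unpunch-self zero    = refl
unpunch-self (suc p) rewrite unpunch-self p = refl

unpunch-punch : ∀ p x → unpunch p (punch p x) ≡ just x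
unpunch-punch zero    x       = refl
unpunch-punch (suc p) zero    = refl
unpunch-punch (suc p) (suc x) rewrite unpunch-punch p x = refl

data PunchView (p : ℕ) : ℕ → Set where
  hole : PunchView p p
  old  : ∀ x → PunchView p (punch p x)

punchView : ∀ p x → PunchView p x
punchView zero    zero    = hole
punchView zero    (suc x) = old x
punchView (suc p) zero    = old zero
punchView (suc p) (suc x) with punchView p x
... | hole  = hole
... | old y = old (suc y)

punch-mono-< : ∀ p {x y} → x < y → punch p x < punch p y
punch-mono-< zero    x<y = s<s x<y
punch-mono-< (suc p) {zero}  {suc y} x<y = z<s
punch-mono-< (suc p) {suc x} {suc y} x<y = s<s (punch-mono-< p (s<s⁻¹ x<y))

punch-cancel-< : ∀ p {x y} → punch p x < punch p y → x < y
punch-cancel-< zero    h = s<s⁻¹ h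
punch-cancel-< (suc p) {zero}  {suc y} h = z<s
punch-cancel-< (suc p) {suc x} {suc y} h = s<s (punch-cancel-< p (s<s⁻¹ h))

punch-injective : ∀ p {x y} → punch p x ≡ punch p y → x ≡ y
punch-injective zero    h = suc-injective h
punch-injective (suc p) {zero}  {zero}  h = refl
punch-injective (suc p) {suc x} {suc y} h = cong suc (punch-injective p (suc-injective h))

x≤punch : ∀ p x → x ≤ punch p x
x≤punch zero    x       = n≤1+n x
x≤punch (suc p) zero    = z≤n
x≤punch (suc p) (suc x) = s≤s (x≤punch p x)

punch≤1+x : ∀ p x → punch p x ≤ suc x
punch≤1+x zero    x       = ≤-refl
punch≤1+x (suc p) zero    = z≤n
punch≤1+x (suc p) (suc x) = s≤s (punch≤1+x p x)

punch-below : ∀ {p x} → x < p → punch p x ≡ x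
punch-below {suc p} {zero}  x<p = refl
punch-below {suc p} {suc x} x<p = cong suc (punch-below (s<s⁻¹ x<p))

punch-above : ∀ {p x} → p ≤ x → punch p x ≡ suc x
punch-above {zero}          p≤x = refl
punch-above {suc p} {suc x} p≤x = cong suc (punch-above (s≤s⁻¹ p≤x))

punch≢hole : ∀ p x → punch p x ≢ p
punch≢hole (suc p) (suc x) h = punch≢hole p x (suc-injective h)

-- Inserting a 3-cycle into a function

-- The new points are 0, 1 + t and 2 + M; `emb t M` enumerates the others.
emb : ℕ → ℕ → ℕ → ℕ
emb t M = suc ∘ punch t ∘ punch M

insert : ℕ → ℕ → (ℕ → ℕ) → ℕ → ℕ
insert t M σ zero    = 2 + M
insert t M σ (suc y) =
  -- The defaults are the images of the new points: 0 for `1 + t`, detected by `unpunch t`, and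
  -- `suc t` for `2 + M`, detected by `unpunch M`.
  maybe′ (λ z → maybe′ (emb t M ∘ σ) (suc t) (unpunch M z)) 0 (unpunch t y)

module _ {t M : ℕ} where

  emb-mono-< : ∀ {x y} → x < y → emb t M x < emb t M y
  emb-mono-< = s<s ∘ punch-mono-< t ∘ punch-mono-< M

  emb-cancel-< : ∀ {x y} → emb t M x < emb t M y → x < y
  emb-cancel-< = punch-cancel-< M ∘ punch-cancel-< t ∘ s<s⁻¹

  emb-injective : ∀ {x y} → emb t M x ≡ emb t M y → x ≡ y
  emb-injective = punch-injective M ∘ punch-injective t ∘ suc-injective

  emb≤3+ : ∀ x → emb t M x ≤ 3 + x
  emb≤3+ x = s≤s (≤-trans (punch≤1+x t _) (s≤s (punch≤1+x M x)))

  -- For t ≤ M, the numbers t and M count the old points below `1 + t` and `2 + M`, so comparisons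
  -- with new points become comparisons with t and M.
  emb<1+t⁻ : ∀ {x} → emb t M x < suc t → x < t
  emb<1+t⁻ {x} h =
    ≤-<-trans (≤-trans (x≤punch M x) (x≤punch t _)) (s<s⁻¹ h)

  module _ (t≤M : t ≤ M) where

    -- This makes `2 + M` the point at which the inner `unpunch M` of `insert` fails.
    last-punched : punch t M ≡ suc M
    last-punched = punch-above t≤M

    emb<1+t : ∀ {x} → x < t → emb t M x < suc t
    emb<1+t {x} x<t
      rewrite punch-below {M} {x} (<-≤-trans x<t t≤M) | punch-below {t} {x} x<t = s<s x<t

    1+t<emb⁻ : ∀ {x} → suc t < emb t M x → t ≤ x
    1+t<emb⁻ h = ≮⇒≥ λ x<t → <-asym h (emb<1+t x<t)

    1+t<emb : ∀ {x} → t ≤ x → suc t < emb t M x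
    1+t<emb {x} t≤x = ≤∧≢⇒< (≮⇒≥ (λ h → <⇒≱ (emb<1+t⁻ h) t≤x))
                        (punch≢hole t _ ∘ suc-injective ∘ sym)

    emb<2+M⁻ : ∀ {x} → emb t M x < 2 + M → x < M
    emb<2+M⁻ {x} h = ≤-<-trans (x≤punch M x)
      (punch-cancel-< t (subst (punch t (punch M x) <_) (sym last-punched) (s<s⁻¹ h)))

    emb<2+M : ∀ {x} → x < M → emb t M x < 2 + M
    emb<2+M {x} x<M rewrite punch-below x<M = s<s (≤-<-trans (punch≤1+x t x) (s<s x<M))

    2+M<emb⁻ : ∀ {x} → 2 + M < emb t M x → M ≤ x
    2+M<emb⁻ h = ≮⇒≥ λ x<M → <-asym h (emb<2+M x<M)

    emb≡3+ : ∀ {x} → M ≤ x → emb t M x ≡ 3 + x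
    emb≡3+ {x} M≤x rewrite punch-above M≤x =
      cong suc (punch-above (≤-trans t≤M (≤-trans M≤x (n≤1+n x))))

    2+M<emb : ∀ {x} → M ≤ x → 2 + M < emb t M x
    2+M<emb M≤x rewrite emb≡3+ M≤x = s≤s (s≤s (s≤s M≤x))

    data Point : ℕ → Set where
      first : Point 0
      mid   : Point (suc t)
      last  : Point (2 + M)
      old   : ∀ x → Point (emb t M x)

    point : ∀ x → Point x
    point zero = first
    point (suc y) with punchView t y
    ... | hole  = mid
    ... | old z with punchView M z
    ...   | hole  = subst (Point ∘ suc) (sym last-punched) last
    ...   | old x = old x

  module _ (σ : ℕ → ℕ) where

    insert-mid : insert t M σ (suc t) ≡ 0
    insert-mid rewrite unpunch-self t = refl

    insert-old : ∀ x → insert t M σ (emb t M x) ≡ emb t M (σ x)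
    insert-old x rewrite unpunch-punch t (punch M x) | unpunch-punch M x = refl

    insert-last : t ≤ M → insert t M σ (2 + M) ≡ suc t
    insert-last t≤M
      rewrite sym (last-punched t≤M) | unpunch-punch t M | unpunch-self M = refl

  -- Every number is 0, `1 + t`, `2 + M` or an old point, so these equations determine the function.
  insert-unique : (t≤M : t ≤ M) {f σ : ℕ → ℕ} →
    f 0 ≡ 2 + M → f (2 + M) ≡ suc t → f (suc t) ≡ 0 →
    (∀ x → f (emb t M x) ≡ emb t M (σ x)) → insert t M σ ≗ f
  insert-unique t≤M {f} {σ} f0 fK fC fe x with point t≤M x
  ... | first = sym f0
  ... | mid   = trans (insert-mid σ) (sym fC)
  ... | last  = trans (insert-last σ t≤M) (sym fK)
  ... | old y = trans (insert-old σ y) (sym (fe y))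

insert-cong : ∀ {t t′ M M′ σ σ′} → t ≡ t′ → M ≡ M′ → t ≤ M → σ ≗ σ′ →
  insert t M σ ≗ insert t′ M′ σ′
insert-cong {t} {_} {M} {_} {σ} {σ′} refl refl t≤M σ≗σ′ =
  insert-unique t≤M refl (insert-last σ′ t≤M) (insert-mid {t} {M} σ′)
    λ x → trans (insert-old σ′ x) (cong (emb t M) (sym (σ≗σ′ x)))

-- The value at 0 reveals M, the value at `2 + M` reveals t, and the values at the old points reveal
-- σ.
insert-injective : ∀ {t t′ M M′ σ σ′} → t ≤ M → t′ ≤ M′ →
  insert t M σ ≗ insert t′ M′ σ′ → t ≡ t′ × M ≡ M′ × σ ≗ σ′
insert-injective {t} {t′} {M} {σ = σ} {σ′} t≤M t′≤M′ eq
  with refl ← suc-injective (suc-injective (eq 0))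
  with refl ← suc-injective (trans (sym (insert-last σ t≤M)) (trans (eq (2 + M)) (insert-last σ′ t′≤M′)))
  = refl , refl , λ x → emb-injective {t} {M}
      (trans (sym (insert-old σ x)) (trans (eq (emb t M x)) (insert-old σ′ x)))

-- Prepending a fixed point

shift : (ℕ → ℕ) → ℕ → ℕ
shift σ zero    = zero
shift σ (suc x) = suc (σ x)

shift-cong : ∀ {σ τ} → σ ≗ τ → shift σ ≗ shift τ
shift-cong eq zero    = refl
shift-cong eq (suc x) = cong suc (eq x)

shift-injective : ∀ {σ τ} → shift σ ≗ shift τ → σ ≗ τ
shift-injective eq x = suc-injective (eq (suc x))

-- Permutations of ℕ with cube 1 avoiding 231

-- A permutation of {0,…,n-1} is extended by the identity to all of ℕ.
record Good (n : ℕ) (f : ℕ → ℕ) : Set where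
  field
    cube  : ∀ x → f (f (f x)) ≡ x
    fixed : ∀ x → n ≤ x → f x ≡ x
    avoid : ∀ {i j k} → i < j → j < k → f k < f i → f i < f j → ⊥

  injective : ∀ {x y} → f x ≡ f y → x ≡ y
  injective {x} {y} eq = trans (sym (cube x)) (trans (cong (f ∘ f) eq) (cube y))

  bounded : ∀ {x} → x < n → f x < n
  bounded {x} x<n = ≰⇒> λ n≤fx →
    <⇒≱ x<n (subst (n ≤_) (injective (fixed (f x) n≤fx)) n≤fx)

  -- If f x > f 0 with x ≤ f 0, avoidance puts the values below f 0 at positions
  -- below x, so [0, f 0) is closed under f ∘ f, hence under f = (f ∘ f) ∘ (f ∘ f).
  block : ∀ {x} → x ≤ f 0 → f x ≤ f 0
  block {x} x≤K = ≮⇒≥ λ K<fx →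
    let
      0<x : 0 < x
      0<x = n≢0⇒n>0 λ { refl → <-irrefl refl K<fx }
      square-< : ∀ {v} → v < f 0 → f (f v) < f 0
      square-< {v} v<K = <-≤-trans (≤∧≢⇒<
        (≮⇒≥ λ x<p → avoid 0<x x<p (subst (_< f 0) (sym (cube v)) v<K) K<fx)
        λ p≡x → <-asym v<K (subst (f 0 <_) (trans (cong f (sym p≡x)) (cube v)) K<fx)) x≤K
    in <-irrefl refl (subst (_< f 0) (cong f (cube 0))
         (square-< (square-< (<-≤-trans 0<x x≤K))))

open Good

Closed : ℕ → (ℕ → ℕ) → Set
Closed M σ = ∀ {x} → x < M → σ x < M

-- The conditions under which inserting the cycle 0 ↦ 2+M ↦ 1+t ↦ 0 creates no 231.
record Insertable (t M : ℕ) (σ : ℕ → ℕ) : Set where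
  field
    t≤M         : t ≤ M
    closed      : Closed M σ
    low-places  : ∀ {u v} → u < v → v < t → σ u < σ v → ⊥
    high-values : ∀ {u v} → u < v → v < M → t ≤ σ u → σ u < σ v → ⊥

open Insertable

empty-good : Good 0 id
empty-good = record
  { cube  = λ _ → refl
  ; fixed = λ _ _ → refl
  ; avoid = λ i<j j<k k<i _ → <-asym (<-trans i<j j<k) k<i
  }

shift-good : ∀ {n σ} → Good n σ → Good (suc n) (shift σ)
shift-good {n} {σ} g = record { cube = c ; fixed = fx ; avoid = av }
  where
  c : ∀ x → shift σ (shift σ (shift σ x)) ≡ x
  c zero    = refl
  c (suc x) = cong suc (cube g x)
  fx : ∀ x → suc n ≤ x → shift σ x ≡ x
  fx (suc x) n≤x = cong suc (fixed g x (s≤s⁻¹ n≤x))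
  av : ∀ {i j k} → i < j → j < k → shift σ k < shift σ i → shift σ i < shift σ j → ⊥
  av {suc i} {suc j} {suc k} i<j j<k p q =
    avoid g (s<s⁻¹ i<j) (s<s⁻¹ j<k) (s<s⁻¹ p) (s<s⁻¹ q)

unshift : ∀ {n f} → Good (suc n) f → f 0 ≡ 0 → ∃ λ σ → Good n σ × shift σ ≗ f
unshift {n} {f} g f0 = σ , good , eq
  where
  -- By injectivity f takes the value 0 only at 0, so `pred` loses nothing at positive places.
  positive : ∀ x → suc (pred (f (suc x))) ≡ f (suc x)
  positive x with f (suc x) in fx
  ... | suc _ = refl
  ... | zero  with () ← injective g (trans fx (sym f0))
  σ : ℕ → ℕ
  σ x = pred (f (suc x))
  eq : shift σ ≗ f
  eq zero    = sym f0
  eq (suc x) = positive x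
  good : Good n σ
  good = record
    { cube  = λ x → suc-injective (trans (positive _)
        (trans (cong f (trans (positive _) (cong f (positive x)))) (cube g (suc x))))
    ; fixed = λ x n≤x → cong pred (fixed g (suc x) (s≤s n≤x))
    ; avoid = λ {i} {j} {k} i<j j<k p q → avoid g (s<s i<j) (s<s j<k)
        (subst₂ _<_ (positive k) (positive i) (s<s p))
        (subst₂ _<_ (positive i) (positive j) (s<s q))
    }

-- Inserting a cycle

module _ {n t M σ} (g : Good n σ) (ins : Insertable t M σ) where

  private
    f = insert t M σ

    -- As a relation, the graph lets one match split a point and its value together.
    data Graph : ℕ → ℕ → Set where
      first : Graph 0 (2 + M)
      mid   : Graph (suc t) 0
      last  : Graph (2 + M) (suc t)
      old   : ∀ x → Graph (emb t M x) (emb t M (σ x))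

    graph : ∀ x → Graph x (f x)
    graph x with point (t≤M ins) x
    ... | first = first
    ... | mid   = subst (Graph _) (sym (insert-mid {t} {M} σ)) mid
    ... | last  = subst (Graph _) (sym (insert-last σ (t≤M ins))) last
    ... | old y = subst (Graph _) (sym (insert-old σ y)) (old y)

    closed-above : ∀ {x} → M ≤ σ x → M ≤ x
    closed-above M≤ = ≮⇒≥ λ x<M → <⇒≱ (closed ins x<M) M≤

    -- Since x = σ (σ (σ x)), pulling the bound back through σ twice suffices.
    above : ∀ {x} → M ≤ x → M ≤ σ x
    above {x} M≤x = closed-above (closed-above (subst (M ≤_) (sym (cube g x)) M≤x))

    beyond : ∀ {k c} → Graph k c → 2 + M < k → 2 + M < c
    beyond first   ()
    beyond mid     h = contradiction (s<s⁻¹ h) (≤⇒≯ (≤-trans (t≤M ins) (n≤1+n M)))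
    beyond last    h = contradiction h (<-irrefl refl)
    beyond (old x) h = 2+M<emb (t≤M ins) (above (2+M<emb⁻ (t≤M ins) h))

    -- If 0 is the first place, or `2 + M` the first or second, the third place would lie beyond
    -- `2 + M`, where values are too large. The value 0 at `1 + t` can only come third, which
    -- `low-places` excludes; `2 + M` as third place, with value `1 + t`, is excluded by
    -- `high-values`. Three old points would already form 231 in σ.
    avoid′ : ∀ {i j k a b c} → Graph i a → Graph j b → Graph k c →
             i < j → j < k → c < a → a < b → ⊥
    avoid′ first (old x) gk i<j j<k c<a a<b =
      <-asym c<a (beyond gk (<-trans
        (2+M<emb (t≤M ins) (closed-above (2+M<emb⁻ (t≤M ins) a<b))) j<k))
    avoid′ first last _ i<j j<k c<a a<b =
      <⇒≱ (s<s⁻¹ a<b) (≤-trans (t≤M ins) (n≤1+n M))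
    avoid′ last gj gk i<j j<k c<a a<b =
      <-asym c<a (<-trans (s≤s (s≤s (t≤M ins))) (beyond gk (<-trans i<j j<k)))
    avoid′ (old u) last gk i<j j<k c<a a<b =
      <-asym (<-trans c<a a<b) (<-trans (s≤s (s≤s (t≤M ins))) (beyond gk j<k))
    avoid′ (old u) (old v) mid i<j j<k c<a a<b =
      low-places ins (emb-cancel-< {t} {M} i<j) (emb<1+t⁻ {t} {M} j<k) (emb-cancel-< {t} {M} a<b)
    avoid′ (old u) (old v) last i<j j<k c<a a<b =
      high-values ins (emb-cancel-< {t} {M} i<j) (emb<2+M⁻ (t≤M ins) j<k)
        (1+t<emb⁻ (t≤M ins) c<a) (emb-cancel-< {t} {M} a<b)
    avoid′ (old u) (old v) (old w) i<j j<k c<a a<b =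
      avoid g (emb-cancel-< {t} {M} i<j) (emb-cancel-< {t} {M} j<k)
        (emb-cancel-< {t} {M} c<a) (emb-cancel-< {t} {M} a<b)

    cube′ : ∀ x → f (f (f x)) ≡ x
    cube′ x with point (t≤M ins) x
    ... | first = trans (cong f (insert-last σ (t≤M ins))) (insert-mid {t} {M} σ)
    ... | mid   = trans (cong (f ∘ f) (insert-mid {t} {M} σ)) (insert-last σ (t≤M ins))
    ... | last  = trans (cong (f ∘ f) (insert-last σ (t≤M ins))) (cong f (insert-mid {t} {M} σ))
    ... | old y = trans (cong (f ∘ f) (insert-old σ y)) (trans (cong f (insert-old σ (σ y)))
                    (trans (insert-old σ (σ (σ y))) (cong (emb t M) (cube g y))))

  insert-good : M ≤ n → Good (3 + n) (insert t M σ)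
  insert-good M≤n = record
    { cube  = cube′
    ; fixed = λ x → fixed′ x (point (t≤M ins) x)
    ; avoid = avoid′ (graph _) (graph _) (graph _)
    }
    where
    fixed′ : ∀ x → Point (t≤M ins) x → 3 + n ≤ x → f x ≡ x
    fixed′ _ first   ()
    fixed′ _ mid     h = contradiction (s≤s⁻¹ h) (<⇒≱ (s≤s (≤-trans (t≤M ins) (≤-trans M≤n (n≤1+n n)))))
    fixed′ _ last    h = contradiction (s≤s⁻¹ (s≤s⁻¹ h)) (<⇒≱ (s≤s M≤n))
    fixed′ _ (old y) h = trans (insert-old σ y)
      (cong (emb t M) (fixed g y (s≤s⁻¹ (s≤s⁻¹ (s≤s⁻¹ (≤-trans h (emb≤3+ {t} {M} y)))))))

-- Removing the cycle of the first point

record Removal (n : ℕ) (f : ℕ → ℕ) : Set where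
  field
    {size t M}  : ℕ
    {σ}         : ℕ → ℕ
    size-eq     : n ≡ 3 + size
    M≤size      : M ≤ size
    rest-good   : Good size σ
    insertable  : Insertable t M σ
    insert-eq   : insert t M σ ≗ f

module _ {n f t M} (g : Good (3 + n) f) (T≤M : t ≤ M) (M≤n : M ≤ n)
         (f0 : f 0 ≡ 2 + M) (fK : f (2 + M) ≡ suc t) (fC : f (suc t) ≡ 0) where

  private
    -- f is injective and permutes the three new points, so no old point is sent to one of them.
    image : ∀ x {z} → f (emb t M x) ≡ z → Point T≤M z → ∃ λ y → z ≡ emb t M y
    image x eq (old y) = y , refl
    image x eq first   =
      contradiction (suc-injective (injective g (trans eq (sym fC)))) (punch≢hole t _)
    image x eq mid     = contradiction (punch-injective t (suc-injective
      (trans (injective g (trans eq (sym fK))) (cong suc (sym (last-punched T≤M))))))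
      (punch≢hole M x)
    image x eq last    = contradiction (injective g (trans eq (sym f0))) 1+n≢0

    σ : ℕ → ℕ
    σ x = proj₁ (image x refl (point T≤M _))

    σ-eq : ∀ x → f (emb t M x) ≡ emb t M (σ x)
    σ-eq x = proj₂ (image x refl (point T≤M _))

    f<f : ∀ {u v} → σ u < σ v → f (emb t M u) < f (emb t M v)
    f<f {u} {v} p = subst₂ _<_ (sym (σ-eq u)) (sym (σ-eq v)) (emb-mono-< {t} {M} p)

    σ-good : Good n σ
    σ-good = record
      { cube  = λ x → emb-injective {t} {M} (trans (sym (σ-eq _))
          (trans (cong f (trans (sym (σ-eq _)) (cong f (sym (σ-eq x))))) (cube g _)))
      ; fixed = λ x n≤x → emb-injective {t} {M} (trans (sym (σ-eq x))
          (fixed g _ (subst (3 + n ≤_) (sym (emb≡3+ T≤M (≤-trans M≤n n≤x)))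
            (s≤s (s≤s (s≤s n≤x))))))
      ; avoid = λ i<j j<k p q →
          avoid g (emb-mono-< {t} {M} i<j) (emb-mono-< {t} {M} j<k) (f<f p) (f<f q)
      }

    -- Closedness comes from `block` for f. A violation of the other two conditions would be
    -- completed to 231 by the value 0 at place `1 + t`, or by the value `1 + t` at place `2 + M`.
    σ-insertable : Insertable t M σ
    σ-insertable = record
      { t≤M         = T≤M
      ; closed      = λ {x} x<M → emb<2+M⁻ T≤M (≤∧≢⇒<
          (subst₂ _≤_ (σ-eq x) f0
            (block g (subst (emb t M x ≤_) (sym f0) (<⇒≤ (emb<2+M T≤M x<M)))))
          (λ eq → 1+n≢0 (injective g (trans (trans (σ-eq x) eq) (sym f0)))))
      ; low-places  = λ {u} u<v v<t p → avoid g (emb-mono-< {t} {M} u<v) (emb<1+t T≤M v<t)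
          (subst₂ _<_ (sym fC) (sym (σ-eq u)) z<s) (f<f p)
      ; high-values = λ {u} u<v v<M t≤σu p → avoid g (emb-mono-< {t} {M} u<v) (emb<2+M T≤M v<M)
          (subst₂ _<_ (sym fK) (sym (σ-eq u)) (1+t<emb T≤M t≤σu)) (f<f p)
      }

  remove-cycle : Removal (3 + n) f
  remove-cycle = record
    { size-eq    = refl
    ; M≤size     = M≤n
    ; rest-good  = σ-good
    ; insertable = σ-insertable
    ; insert-eq  = insert-unique T≤M f0 fK fC σ-eq
    }

remove : ∀ {n f} → Good n f → f 0 ≢ 0 → Removal n f
remove {n} {f} g f0≢0 = go n (f 0) (f (f 0)) g refl refl (cube g 0) K<n C<K
  where
  C≢0 : f (f 0) ≢ 0
  C≢0 eq = f0≢0 (trans (cong f (sym eq)) (cube g 0))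
  C≢K : f (f 0) ≢ f 0
  C≢K eq = f0≢0 (injective g eq)
  C<K : f (f 0) < f 0
  C<K = ≤∧≢⇒< (block g ≤-refl) C≢K
  K<n : f 0 < n
  K<n = ≰⇒> λ n≤K → C≢K (fixed g (f 0) n≤K)
  -- K and C are generalised so that they can be matched as `2 + M` and `1 + t`; 0 < C < K < n
  -- leaves only this shape.
  go : ∀ n K C → Good n f → f 0 ≡ K → f (f 0) ≡ C → f (f (f 0)) ≡ 0 → K < n → C < K →
       Removal n f
  go n K zero _ _ ff0 _ _ _ = contradiction ff0 C≢0
  go (suc (suc (suc n))) (suc (suc M)) (suc t) g f0 ff0 fff0 K<n C<K =
    remove-cycle g (s≤s⁻¹ (s≤s⁻¹ C<K)) (s≤s⁻¹ (s≤s⁻¹ (s≤s⁻¹ K<n)))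
      f0 (trans (cong f (sym f0)) ff0) (trans (cong f (sym ff0)) fff0)
  go (suc (suc zero)) (suc (suc M)) (suc t) _ _ _ _ (s≤s (s≤s ())) _
  go (suc zero) (suc (suc M)) (suc t) _ _ _ _ (s≤s ()) _
  go _ (suc zero) (suc t) _ _ _ _ _ (s≤s ())

-- Classifying the cycles that can be inserted

module _ {n t m σ} (g : Good n σ) (ins : Insertable t (suc m) σ) where

  private
    closed≤ : ∀ {x} → x ≤ m → σ x ≤ m
    closed≤ x≤m = s≤s⁻¹ (closed ins (s≤s x≤m))

    -- As σ has cube 1, `σ (σ v)` is the place where the value v stands.
    place : ∀ {v} → v ≤ m → σ (σ v) ≤ m
    place = closed≤ ∘ closed≤

    value≢ : ∀ {x y z} → σ x ≡ y → y ≢ z → σ (σ z) ≢ x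
    value≢ {z = z} σx y≢z eq = y≢z (trans (sym σx) (trans (cong σ (sym eq)) (cube g z)))

    nonzero : ∀ {x y} → σ x ≡ 0 → y ≢ x → 0 < σ y
    nonzero σx y≢x = n≢0⇒n>0 λ σy → y≢x (injective g (trans σy (sym σx)))

    -- Values from t on decrease from left to right and place 0 carries one, so it carries the
    -- largest, m; hence 0 stands at place `σ m`. If t exceeded `suc (σ m)`, this 0 would be
    -- followed by a larger value at a low place. If t were below `σ m`, the value one less than
    -- `σ m` would be high and stand before place m, where `σ m` stands.
    high-start : t ≤ σ 0 → σ 0 ≡ m × (t ≡ σ m ⊎ t ≡ suc (σ m))
    high-start t≤σ0 = σ0≡m , choose
      where
      σ0≡m : σ 0 ≡ m
      σ0≡m with σ 0 ≟ m
      ... | yes eq = eq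
      ... | no neq = ⊥-elim (high-values ins
              (n≢0⇒n>0 (value≢ refl neq)) (s≤s (place ≤-refl)) t≤σ0
              (subst (σ 0 <_) (sym (cube g m)) (≤∧≢⇒< (closed≤ z≤n) neq)))
      σq≡0 : σ (σ m) ≡ 0
      σq≡0 = trans (cong (σ ∘ σ) (sym σ0≡m)) (cube g 0)
      t≤1+q : t ≤ suc (σ m)
      t≤1+q = ≮⇒≥ λ 1+q<t → low-places ins (n<1+n (σ m)) 1+q<t
        (subst (_< σ (suc (σ m))) (sym σq≡0) (nonzero σq≡0 1+n≢n))
      q≤t : σ m ≤ t
      q≤t = ≮⇒≥ λ t<q → before (σ m) refl t<q
        where
        before : ∀ q → σ m ≡ q → t < q → ⊥
        before (suc q) σm t<q = high-values ins
          (≤∧≢⇒< (place (≤-trans (n≤1+n q) (subst (_≤ m) σm (closed≤ ≤-refl)))) (value≢ σm 1+n≢n))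
          (n<1+n m)
          (subst (t ≤_) (sym (cube g q)) (s≤s⁻¹ t<q))
          (subst₂ _<_ (sym (cube g q)) (sym σm) (n<1+n q))
      choose : t ≡ σ m ⊎ t ≡ suc (σ m)
      choose with t ≟ σ m
      ... | yes eq = inj₁ eq
      ... | no neq = inj₂ (≤-antisym t≤1+q (≤∧≢⇒< q≤t (neq ∘ sym)))

    -- σ reverses [0,t), so σ³ = 1 leaves only t = 1.
    low-start : ∀ {s} → t ≡ suc s → σ 0 ≤ s → s ≡ 0 × σ 0 ≡ 0
    low-start {s} refl σ0≤s = s≡0 , trans σ0≡s s≡0
      where
      -- On these places σ decreases, so all values are bounded by the one at 0.
      low : ∀ {v} → v ≤ s → σ v ≤ s
      low {zero}  _   = σ0≤s
      low {suc v} v≤s = ≤-trans (≮⇒≥ (low-places ins z<s (s≤s v≤s))) σ0≤s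
      σ0≡s : σ 0 ≡ s
      σ0≡s with σ 0 ≟ s
      ... | yes eq = eq
      ... | no neq = ⊥-elim (low-places ins (n≢0⇒n>0 (value≢ refl neq)) (s≤s (low (low ≤-refl)))
              (subst (σ 0 <_) (sym (cube g s)) (≤∧≢⇒< σ0≤s neq)))
      -- `σ (σ 0)` is the place of the least value 0, which must come last in a decreasing run.
      p≡s : σ (σ 0) ≡ s
      p≡s = ≤-antisym (low (low z≤n)) (≮⇒≥ λ p<s → low-places ins (n<1+n _) (s≤s p<s)
        (subst (_< σ (suc (σ (σ 0)))) (sym (cube g 0)) (nonzero (cube g 0) 1+n≢n)))
      s≡0 : s ≡ 0
      s≡0 = trans (sym p≡s) (trans (cong σ (trans σ0≡s (sym p≡s))) (cube g 0))

    -- Every nonzero value is now high, so these values decrease on [1, m]. Thus σ exchanges 1 and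
    -- m, and cube 1 forces m = 1.
    low-rest : t ≡ 1 → σ 0 ≡ 0 → m ≢ 0 → m ≡ 1 × σ 1 ≡ 1
    low-rest refl σ0 m≢0 = m≡1 , trans σ1≡m m≡1
      where
      1≤m : 1 ≤ m
      1≤m = n≢0⇒n>0 m≢0
      σ1≡m : σ 1 ≡ m
      σ1≡m with σ 1 ≟ m
      ... | yes eq = eq
      ... | no neq = ⊥-elim (high-values ins
              (≤∧≢⇒< (n≢0⇒n>0 (value≢ σ0 (m≢0 ∘ sym))) (value≢ refl neq ∘ sym))
              (s≤s (place ≤-refl)) (nonzero σ0 1+n≢0)
              (subst (σ 1 <_) (sym (cube g m)) (≤∧≢⇒< (closed≤ 1≤m) neq)))
      σm≡1 : σ m ≡ 1
      σm≡1 with σ m ≟ 1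
      ... | yes eq = eq
      ... | no neq = ⊥-elim (high-values ins
              (≤∧≢⇒< (place 1≤m) (value≢ refl neq)) (n<1+n m)
              (≤-reflexive (sym (cube g 1)))
              (subst (_< σ m) (sym (cube g 1)) (≤∧≢⇒< (nonzero σ0 m≢0) (neq ∘ sym))))
      m≡1 : m ≡ 1
      m≡1 = trans (sym σ1≡m) (trans (cong σ (trans (sym σm≡1) (cong σ (sym σ1≡m)))) (cube g 1))

  -- The first alternative is 52143, the second doubles the three points of the
  -- cycle 0 ↦ m ↦ σ m ↦ 0 of σ (which may be a fixed point).
  Classification : Set
  Classification = (m ≡ 1 × t ≡ 1 × σ 0 ≡ 0 × σ 1 ≡ 1) ⊎
                   (σ 0 ≡ m × (t ≡ σ m ⊎ t ≡ suc (σ m)))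

  classify : Classification
  classify with t ≤? σ 0
  ... | yes t≤σ0 = inj₂ (high-start t≤σ0)
  ... | no  t≰σ0 = low t refl (≰⇒> t≰σ0)
    where
    low : ∀ t′ → t ≡ t′ → σ 0 < t′ → Classification
    low (suc s) t≡ σ0<t with low-start t≡ (s≤s⁻¹ σ0<t)
    ... | refl , σ0 with m ≟ 0
    -- This doubles the fixed point 0, with the copy directly after it.
    ...   | yes m≡0 = inj₂ (trans σ0 (sym m≡0) , inj₂ (trans t≡ (cong suc (sym (trans (cong σ m≡0) σ0)))))
    ...   | no  m≢0 = let m≡1 , σ1 = low-rest t≡ σ0 m≢0 in inj₁ (m≡1 , t≡ , σ0 , σ1)

-- Put c = `σ (σ 0)`. In σ itself, the value 0 at place c and the value c at place `σ 0` complete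
-- any forbidden ascending pair to 231.
double-insertable : ∀ {n σ t} → Good n σ → t ≡ σ (σ 0) ⊎ t ≡ suc (σ (σ 0)) →
  Insertable t (suc (σ 0)) σ
double-insertable {σ = σ} {t} g t≡ = record
  { t≤M         = ≤-trans t≤ (s≤s (block g ≤-refl))
  ; closed      = λ x<M → s≤s (block g (s≤s⁻¹ x<M))
  ; low-places  = λ {u} {v} u<v v<t σu<σv →
      let v≤c = s≤s⁻¹ (<-≤-trans v<t t≤) in
      avoid g u<v
        -- At place c the value is 0, which cannot be the larger of the pair.
        (≤∧≢⇒< v≤c λ { refl → n≮0 (subst (σ u <_) (cube g 0) σu<σv) })
        (subst (_< σ u) (sym (cube g 0)) (n≢0⇒n>0 λ σu →
          <⇒≢ (<-≤-trans u<v v≤c) (injective g (trans σu (sym (cube g 0))))))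
        σu<σv
  ; high-values = λ {u} {v} u<v v<M t≤σu σu<σv →
      let v≤K = s≤s⁻¹ v<M
          c≤σu = ≤-trans ≤t t≤σu in
      avoid g u<v
        (≤∧≢⇒< v≤K λ { refl → <⇒≱ σu<σv c≤σu })
        (≤∧≢⇒< c≤σu λ c≡σu → <⇒≢ (<-≤-trans u<v v≤K) (injective g (sym c≡σu)))
        σu<σv
  }
  where
  t≤ : t ≤ suc (σ (σ 0))
  t≤ = Sum.[ (λ { refl → n≤1+n _ }) , ≤-reflexive ] t≡
  ≤t : σ (σ 0) ≤ t
  ≤t = Sum.[ ≤-reflexive ∘ sym , (λ { refl → n≤1+n _ }) ] t≡

-- `one`, `three`, `five` prepend the blocks 1, 312, 52143; `left` and `right` double
-- the cycle of the first point, the copy of σ (σ 0) being put before resp. after it.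
data Code : ℕ → Set where
  empty : Code 0
  one   : ∀ {n} → Code n → Code (1 + n)
  three : ∀ {n} → Code n → Code (3 + n)
  left  : ∀ {n} → Code (suc n) → Code (4 + n)
  right : ∀ {n} → Code (suc n) → Code (4 + n)
  five  : ∀ {n} → Code n → Code (5 + n)

-- M = `suc (σ 0)` makes `σ 0` the last old point below the new point `2 + M`.
double-left double-right : (ℕ → ℕ) → ℕ → ℕ
double-left  σ = insert (σ (σ 0)) (suc (σ 0)) σ
double-right σ = insert (suc (σ (σ 0))) (suc (σ 0)) σ

⟦_⟧ : ∀ {n} → Code n → ℕ → ℕ
⟦ empty   ⟧ = id
⟦ one c   ⟧ = shift ⟦ c ⟧
⟦ three c ⟧ = insert 0 0 ⟦ c ⟧
⟦ left c  ⟧ = double-left ⟦ c ⟧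
⟦ right c ⟧ = double-right ⟦ c ⟧
-- The new points 0, 2, 4 interleave with the fixed points, which become 1 and 3; this is the block
-- 52143.
⟦ five c  ⟧ = insert 1 2 (shift (shift ⟦ c ⟧))

⟦⟧-good : ∀ {n} (c : Code n) → Good n ⟦ c ⟧
⟦⟧-good empty     = empty-good
⟦⟧-good (one c)   = shift-good (⟦⟧-good c)
⟦⟧-good (three c) = insert-good (⟦⟧-good c) record
  { t≤M = z≤n ; closed = λ () ; low-places = λ _ () ; high-values = λ _ () } z≤n
⟦⟧-good (left c)  = let g = ⟦⟧-good c in
  insert-good g (double-insertable g (inj₁ refl)) (bounded g z<s)
⟦⟧-good (right c) = let g = ⟦⟧-good c in
  insert-good g (double-insertable g (inj₂ refl)) (bounded g z<s)
⟦⟧-good (five c)  = insert-good (shift-good (shift-good (⟦⟧-good c))) record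
  { t≤M         = s≤s z≤n
  ; closed      = λ { {zero} _ → z<s ; {suc zero} _ → s<s z<s ; {suc (suc _)} (s≤s (s≤s ())) }
  ; low-places  = λ { {v = zero} () _ _ ; {v = suc _} _ (s≤s ()) _ }
  ; high-values = λ { {zero} _ _ () _
                    ; {suc _} {suc zero} (s≤s ()) _ _ _
                    ; {suc _} {suc (suc _)} _ (s≤s (s≤s ())) _ _ }
  } (s≤s (s≤s z≤n))

module _ {n : ℕ} (c : Code n) where
  private σ = ⟦ c ⟧
  left-t≤M : σ (σ 0) ≤ suc (σ 0)
  left-t≤M = t≤M (double-insertable (⟦⟧-good c) (inj₁ refl))
  right-t≤M : suc (σ (σ 0)) ≤ suc (σ 0)
  right-t≤M = t≤M (double-insertable (⟦⟧-good c) (inj₂ refl))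

-- Both would double the same σ, so t would be both `σ (σ 0)` and its successor.
left≢right : ∀ {n} (c d : Code (suc n)) → ¬ (⟦ left c ⟧ ≗ ⟦ right d ⟧)
left≢right c d eq with insert-injective (left-t≤M c) (right-t≤M d) eq
... | t≡ , _ , σ≗ = 1+n≢n (trans (sym t≡) (trans (cong ⟦ c ⟧ (σ≗ 0)) (σ≗ (⟦ d ⟧ 0))))

-- `five` inserts with M = 2 into a function fixing 0, whereas doubling such a function takes M = 1.
left≢five : ∀ {n} (c : Code (2 + n)) (d : Code n) → ¬ (⟦ left c ⟧ ≗ ⟦ five d ⟧)
left≢five c d eq with insert-injective (left-t≤M c) (s≤s z≤n) eq
... | _ , M≡ , σ≗ = 0≢1+n (trans (sym (σ≗ 0)) (suc-injective M≡))

right≢five : ∀ {n} (c : Code (2 + n)) (d : Code n) → ¬ (⟦ right c ⟧ ≗ ⟦ five d ⟧)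
right≢five c d eq with insert-injective (right-t≤M c) (s≤s z≤n) eq
... | _ , M≡ , σ≗ = 0≢1+n (trans (sym (σ≗ 0)) (suc-injective M≡))

⟦⟧-injective : ∀ {n} (c d : Code n) → ⟦ c ⟧ ≗ ⟦ d ⟧ → c ≡ d
⟦⟧-injective empty     empty     eq = refl
⟦⟧-injective (one c)   (one d)   eq = cong one (⟦⟧-injective c d (shift-injective eq))
⟦⟧-injective (three c) (three d) eq =
  cong three (⟦⟧-injective c d (proj₂ (proj₂ (insert-injective z≤n z≤n eq))))
⟦⟧-injective (left c)  (left d)  eq = cong left (⟦⟧-injective c d
  (proj₂ (proj₂ (insert-injective (left-t≤M c) (left-t≤M d) eq))))
⟦⟧-injective (right c) (right d) eq = cong right (⟦⟧-injective c d
  (proj₂ (proj₂ (insert-injective (right-t≤M c) (right-t≤M d) eq))))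
⟦⟧-injective (five c)  (five d)  eq = cong five (⟦⟧-injective c d
  (shift-injective (shift-injective (proj₂ (proj₂ (insert-injective (s≤s z≤n) (s≤s z≤n) eq))))))
⟦⟧-injective (left c)  (right d) eq = ⊥-elim (left≢right c d eq)
⟦⟧-injective (right c) (left d)  eq = ⊥-elim (left≢right d c (sym ∘ eq))
⟦⟧-injective (left c)  (five d)  eq = ⊥-elim (left≢five c d eq)
⟦⟧-injective (five c)  (left d)  eq = ⊥-elim (left≢five d c (sym ∘ eq))
⟦⟧-injective (right c) (five d)  eq = ⊥-elim (right≢five c d eq)
⟦⟧-injective (five c)  (right d) eq = ⊥-elim (right≢five d c (sym ∘ eq))
-- The remaining pairs differ at 0: the value there is 0 for `one`, 2 for `three`, and at least 3
-- for the others.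
⟦⟧-injective (one c)   (three d) eq with () ← eq 0
⟦⟧-injective (one c)   (left d)  eq with () ← eq 0
⟦⟧-injective (one c)   (right d) eq with () ← eq 0
⟦⟧-injective (one c)   (five d)  eq with () ← eq 0
⟦⟧-injective (three c) (one d)   eq with () ← eq 0
⟦⟧-injective (three c) (left d)  eq with () ← eq 0
⟦⟧-injective (three c) (right d) eq with () ← eq 0
⟦⟧-injective (three c) (five d)  eq with () ← eq 0
⟦⟧-injective (left c)  (one d)   eq with () ← eq 0
⟦⟧-injective (left c)  (three d) eq with () ← eq 0
⟦⟧-injective (right c) (one d)   eq with () ← eq 0
⟦⟧-injective (right c) (three d) eq with () ← eq 0
⟦⟧-injective (five c)  (one d)   eq with () ← eq 0
⟦⟧-injective (five c)  (three d) eq with () ← eq 0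

≗-trans : {f g h : ℕ → ℕ} → f ≗ g → g ≗ h → f ≗ h
≗-trans p q x = trans (p x) (q x)

Encodable : ℕ → Set
Encodable n = ∀ {f} → Good n f → ∃ λ (c : Code n) → ⟦ c ⟧ ≗ f

encode : ∀ n → Encodable n
encode = <-rec Encodable step
  where
  step : ∀ n → (∀ {k} → k < n → Encodable k) → Encodable n
  step zero rec g = empty , λ x → sym (fixed g x z≤n)
  step (suc n) rec {f} g with f 0 ≟ 0
  ... | yes f0 =
    let σ , gσ , eq = unshift g f0
        c , ceq     = rec (n<1+n n) gσ
    in one c , ≗-trans (shift-cong ceq) eq
  ... | no f0 with remove g f0
  -- Here t = 0 as well, and the cycle alone forms the block 312.
  ... | record { M = zero ; t = t ; size-eq = refl ; rest-good = gσ ; insertable = ins ; insert-eq = eq } =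
    let c , ceq = rec (m≤n+m _ 2) gσ
    in three c , ≗-trans (insert-cong (sym (n≤0⇒n≡0 (t≤M ins))) refl z≤n ceq) eq
  ... | record { size = suc k ; M = suc m ; σ = σ ; size-eq = refl ; M≤size = M≤ ; rest-good = gσ
               ; insertable = ins ; insert-eq = eq } with classify gσ ins
  -- The code agrees with σ only pointwise, so t and M are recomputed along `ceq`.
  ...   | inj₂ (refl , inj₁ t≡) =
    let c , ceq = rec (m≤n+m _ 2) gσ
    in left c , ≗-trans (insert-cong (trans (trans (cong ⟦ c ⟧ (ceq 0)) (ceq (σ 0))) (sym t≡))
                   (cong suc (ceq 0)) (left-t≤M c) ceq) eq
  ...   | inj₂ (refl , inj₂ t≡) =
    let c , ceq = rec (m≤n+m _ 2) gσ
    in right c , ≗-trans (insert-cong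
                   (trans (cong suc (trans (cong ⟦ c ⟧ (ceq 0)) (ceq (σ 0)))) (sym t≡))
                   (cong suc (ceq 0)) (right-t≤M c) ceq) eq
  ...   | inj₁ (refl , refl , σ0 , σ1) with k | M≤
  ...     | zero  | s≤s ()
  -- As M = 2, at least two points remain; they are the fixed points 0 and 1, stripped before
  -- encoding the rest.
  ...     | suc k | _ =
    let τ , gτ , τeq = unshift gσ σ0
        ρ , gρ , ρeq = unshift gτ (suc-injective (trans (τeq 1) σ1))
        c , ceq      = rec (m≤n+m _ 4) gρ
    in five c , ≗-trans (insert-cong refl refl (s≤s z≤n)
         (≗-trans (shift-cong (≗-trans (shift-cong ceq) ρeq)) τeq)) eq

-- Enumerating the codes

codes empties ones threes lefts rights fives : ∀ n → List (Code n)
codes n = empties n ++ ones n ++ threes n ++ lefts n ++ rights n ++ fives n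
empties zero    = empty ∷ []
empties (suc n) = []
ones zero    = []
ones (suc n) = map one (codes n)
threes (suc (suc (suc n))) = map three (codes n)
threes _                   = []
lefts (suc (suc (suc (suc n)))) = map left (codes (suc n))
lefts _                         = []
rights (suc (suc (suc (suc n)))) = map right (codes (suc n))
rights _                         = []
fives (suc (suc (suc (suc (suc n))))) = map five (codes n)
fives _                               = []

codes-complete : ∀ {n} (c : Code n) → c ∈ codes n
codes-complete empty = here refl
codes-complete {n} (one c) = ∈-++⁺ʳ (empties n) (∈-++⁺ˡ (∈-map⁺ one (codes-complete c)))
codes-complete {n} (three c) =
  ∈-++⁺ʳ (empties n) (∈-++⁺ʳ (ones n) (∈-++⁺ˡ (∈-map⁺ three (codes-complete c))))
codes-complete {n} (left c) = ∈-++⁺ʳ (empties n) (∈-++⁺ʳ (ones n) (∈-++⁺ʳ (threes n)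
  (∈-++⁺ˡ (∈-map⁺ left (codes-complete c)))))
codes-complete {n} (right c) = ∈-++⁺ʳ (empties n) (∈-++⁺ʳ (ones n) (∈-++⁺ʳ (threes n)
  (∈-++⁺ʳ (lefts n) (∈-++⁺ˡ (∈-map⁺ right (codes-complete c))))))
codes-complete {n} (five c) = ∈-++⁺ʳ (empties n) (∈-++⁺ʳ (ones n) (∈-++⁺ʳ (threes n)
  (∈-++⁺ʳ (lefts n) (∈-++⁺ʳ (rights n) (∈-map⁺ five (codes-complete c))))))

tag : ∀ {n} → Code n → ℕ
tag empty     = 0
tag (one _)   = 1
tag (three _) = 2
tag (left _)  = 3
tag (right _) = 4
tag (five _)  = 5

Piece Ranked : ∀ {n} → ℕ → List (Code n) → Set
Piece  k l = Unique l × All (λ c → tag c ≡ k) l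
Ranked k l = Unique l × All (λ c → k ≤ tag c) l

[]-piece : ∀ {n k} → Piece {n} k []
[]-piece = [] , []

map-piece : ∀ {m n k} {con : Code m → Code n} → Injective _≡_ _≡_ con →
  (∀ c → tag (con c) ≡ k) → ∀ {l} → Unique l → Piece k (map con l)
map-piece inj tag≡ {l} u = Unique.map⁺ inj u , All.map⁺ (All.universal tag≡ l)

piece-ranked : ∀ {n k} {l : List (Code n)} → Piece k l → Ranked k l
piece-ranked (u , a) = u , All.map (≤-reflexive ∘ sym) a

-- The two lists are disjoint because every tag in the second exceeds k.
++-ranked : ∀ {n k} {l l′ : List (Code n)} → Piece k l → Ranked (suc k) l′ → Ranked k (l ++ l′)
++-ranked (u , a) (u′ , a′) =
  Unique.++⁺ u u′ (λ (c∈l , c∈l′) → <-irrefl (sym (All.lookup a c∈l)) (All.lookup a′ c∈l′)) ,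
  All.++⁺ (All.map (≤-reflexive ∘ sym) a) (All.map <⇒≤ a′)

codes-unique : ∀ n → Unique (codes n)
empties-piece : ∀ n → Piece 0 (empties n)
ones-piece    : ∀ n → Piece 1 (ones n)
threes-piece  : ∀ n → Piece 2 (threes n)
lefts-piece   : ∀ n → Piece 3 (lefts n)
rights-piece  : ∀ n → Piece 4 (rights n)
fives-piece   : ∀ n → Piece 5 (fives n)

codes-unique n = proj₁ (++-ranked (empties-piece n) (++-ranked (ones-piece n)
  (++-ranked (threes-piece n) (++-ranked (lefts-piece n) (++-ranked (rights-piece n)
  (piece-ranked (fives-piece n)))))))
empties-piece zero    = [] ∷ [] , refl ∷ []
empties-piece (suc n) = []-piece
ones-piece zero    = []-piece
ones-piece (suc n) = map-piece (λ { refl → refl }) (λ _ → refl) (codes-unique n)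
threes-piece 0 = []-piece
threes-piece 1 = []-piece
threes-piece 2 = []-piece
threes-piece (suc (suc (suc n))) =
  map-piece (λ { refl → refl }) (λ _ → refl) (codes-unique n)
lefts-piece 0 = []-piece
lefts-piece 1 = []-piece
lefts-piece 2 = []-piece
lefts-piece 3 = []-piece
lefts-piece (suc (suc (suc (suc n)))) =
  map-piece (λ { refl → refl }) (λ _ → refl) (codes-unique (suc n))
rights-piece 0 = []-piece
rights-piece 1 = []-piece
rights-piece 2 = []-piece
rights-piece 3 = []-piece
rights-piece (suc (suc (suc (suc n)))) =
  map-piece (λ { refl → refl }) (λ _ → refl) (codes-unique (suc n))
fives-piece 0 = []-piece
fives-piece 1 = []-piece
fives-piece 2 = []-piece
fives-piece 3 = []-piece
fives-piece 4 = []-piece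
fives-piece (suc (suc (suc (suc (suc n))))) =
  map-piece (λ { refl → refl }) (λ _ → refl) (codes-unique n)

hasCard-codes : ∀ {n} {A : Set} {P : A → Set} (w : Code n → A) → Injective _≡_ _≡_ w →
  (∀ c → P (w c)) → (∀ x → P x → ∃ λ c → w c ≡ x) → HasCard P (length (codes n))
hasCard-codes {n} {P = P} w inj sound complete =
  map w (codes n) , Unique.map⁺ inj (codes-unique n) , length-map w (codes n) , λ x → mk⇔
    (λ x∈ → let c , _ , eq = ∈-map⁻ w x∈ in subst P (sym eq) (sound c))
    (λ px → let c , eq = complete x px in subst (_∈ map w (codes n)) eq (∈-map⁺ w (codes-complete c)))

-- The generating function

count : ℕ → ℕ
-- The empty permutation is left out, as the series starts at n = 1.
count zero    = 0
count (suc n) = length (codes (suc n))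

-- From length 6 on, all shorter codes used are nonempty, so `count` really counts them. At lengths
-- 1, 3 and 5 the empty code contributes one more, whence the numerator.
count-rec : ∀ n → count (6 + n) ≡
  count (5 + n) + (count (3 + n) + (count (3 + n) + (count (3 + n) + count (1 + n))))
count-rec n =
  trans (length-map-++ one (codes (5 + n))) (cong (_+_ (count (5 + n)))
  (trans (length-map-++ three (codes (3 + n))) (cong (_+_ (count (3 + n)))
  (trans (length-map-++ left (codes (3 + n))) (cong (_+_ (count (3 + n)))
  (trans (length-map-++ right (codes (3 + n))) (cong (_+_ (count (3 + n)))
  (length-map five (codes (1 + n))))))))))
  where
  length-map-++ : ∀ {A B : Set} (h : A → B) xs {ys} →
    length (map h xs ++ ys) ≡ length xs + length ys
  length-map-++ h xs = trans (length-++ (map h xs)) (cong (_+ _) (length-map h xs))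

-- This disposes of the degrees of `denom` beyond 5; p is arbitrary so that the induction can shift
-- it.
sum-zeros : ∀ (h : ℕ → ℤ) (p : ℕ → ℕ) → (∀ k → h (p k) ≡ + 0) → ∀ n →
  sumℤ (map h (applyUpTo p n)) ≡ + 0
sum-zeros h p z zero    = refl
sum-zeros h p z (suc n) = cong₂ ℤ._+_ (z 0) (sum-zeros h (p ∘ suc) (z ∘ suc) n)

count-gf : GFIs count
count-gf = refl , coefficient
  where
  coefficient : ∀ n → (denom ·ˢ (λ k → + count k)) n ≡ numer n
  coefficient 0 = refl
  coefficient 1 = refl
  coefficient 2 = refl
  coefficient 3 = refl
  coefficient 4 = refl
  coefficient 5 = refl
  coefficient (suc (suc (suc (suc (suc (suc n)))))) =
    -- The terms up to degree 5 are written out, with a the newest count and r the vanishing tail.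
    trans (cong₂ (λ a r → + 1 ℤ.* a ℤ.+ (- (+ 1) ℤ.* x₅ ℤ.+ (+ 0 ℤ.* x₄ ℤ.+ (- (+ 3) ℤ.* x₃ ℤ.+
             (+ 0 ℤ.* x₂ ℤ.+ (- (+ 1) ℤ.* x₁ ℤ.+ r))))))
             (cong +_ (count-rec n))
             (sum-zeros (λ k → denom k ℤ.* (+ count (6 + n ∸ k))) (λ k → 6 + k) (λ k → refl) (suc n)))
          (cancel x₅ x₄ x₃ x₂ x₁)
    where
    x₁ x₂ x₃ x₄ x₅ : ℤ
    x₁ = + count (1 + n)
    x₂ = + count (2 + n)
    x₃ = + count (3 + n)
    x₄ = + count (4 + n)
    x₅ = + count (5 + n)
    cancel : ∀ x₅ x₄ x₃ x₂ x₁ →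
      + 1 ℤ.* (x₅ ℤ.+ (x₃ ℤ.+ (x₃ ℤ.+ (x₃ ℤ.+ x₁)))) ℤ.+ (- (+ 1) ℤ.* x₅ ℤ.+ (+ 0 ℤ.* x₄ ℤ.+
      (- (+ 3) ℤ.* x₃ ℤ.+ (+ 0 ℤ.* x₂ ℤ.+ (- (+ 1) ℤ.* x₁ ℤ.+ + 0))))) ≡ + 0
    cancel = solve-∀

-- Words and functions on ℕ

Cube : ∀ {n} → Word n → Set
Cube π = ∀ i → lookup π (lookup π (lookup π i)) ≡ i

Avoids231 Avoids312 : ∀ {n} → Word n → Set
Avoids231 π = ∀ {i j k} → i Fin.< j → j Fin.< k →
  lookup π k Fin.< lookup π i → lookup π i Fin.< lookup π j → ⊥
Avoids312 π = ∀ {i j k} → i Fin.< j → j Fin.< k →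
  lookup π j Fin.< lookup π k → lookup π k Fin.< lookup π i → ⊥

word-ext : ∀ {n} {π ρ : Word n} → (∀ i → lookup π i ≡ lookup ρ i) → π ≡ ρ
word-ext {π = π} {ρ} eq =
  trans (sym (tabulate∘lookup π)) (trans (tabulate-cong eq) (tabulate∘lookup ρ))

data FinView (n : ℕ) : ℕ → Set where
  inside  : (i : Fin n) → FinView n (toℕ i)
  outside : ∀ {x} → n ≤ x → FinView n x

finView : ∀ n x → FinView n x
finView n x with x <? n
... | yes x<n = subst (FinView n) (toℕ-fromℕ< x<n) (inside (fromℕ< x<n))
... | no  x≮n = outside (≮⇒≥ x≮n)

extend : ∀ {n} → Word n → ℕ → ℕ
extend {n} π x with x <? n
... | yes x<n = toℕ (lookup π (fromℕ< x<n))
... | no  _   = x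

extend-inside : ∀ {n} (π : Word n) i → extend π (toℕ i) ≡ toℕ (lookup π i)
extend-inside {n} π i with toℕ i <? n
... | yes i<n = cong (toℕ ∘ lookup π) (fromℕ<-toℕ i i<n)
... | no  i≮n = contradiction (toℕ<n i) i≮n

extend-outside : ∀ {n} (π : Word n) {x} → n ≤ x → extend π x ≡ x
extend-outside {n} π {x} n≤x with x <? n
... | yes x<n = contradiction n≤x (<⇒≱ x<n)
... | no  _   = refl

-- A last place k outside has value k, which exceeds the values at all earlier places; if k is
-- inside, so are i and j.
extend-good : ∀ {n} (π : Word n) → Cube π → Avoids231 π → Good n (extend π)
extend-good {n} π c av = record
  { cube  = λ x → cube′ (finView n x)
  ; fixed = λ x → extend-outside π
  ; avoid = λ {i} {j} {k} → avoid′ (finView n i) (finView n j) (finView n k)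
  }
  where
  f = extend π
  inside₂ : ∀ {i j} → f (toℕ i) < f (toℕ j) → lookup π i Fin.< lookup π j
  inside₂ {i} {j} = subst₂ _<_ (extend-inside π i) (extend-inside π j)
  cube′ : ∀ {x} → FinView n x → f (f (f x)) ≡ x
  cube′ (inside i) = trans (cong (f ∘ f) (extend-inside π i)) (trans (cong f (extend-inside π _))
                       (trans (extend-inside π _) (cong toℕ (c i))))
  cube′ (outside n≤x) = trans (cong (f ∘ f) fx) (trans (cong f fx) fx)
    where fx = extend-outside π n≤x
  avoid′ : ∀ {i j k} → FinView n i → FinView n j → FinView n k →
    i < j → j < k → f k < f i → f i < f j → ⊥
  avoid′ (inside i) (inside j) (inside k) i<j j<k p q = av i<j j<k (inside₂ p) (inside₂ q)
  avoid′ (inside i) _ (outside n≤k) i<j j<k p q = <-asym (toℕ<n (lookup π i))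
    (≤-<-trans n≤k (subst₂ _<_ (extend-outside π n≤k) (extend-inside π i) p))
  avoid′ (outside n≤i) _ (outside n≤k) i<j j<k p q = <-asym (<-trans i<j j<k)
    (subst₂ _<_ (extend-outside π n≤k) (extend-outside π n≤i) p)
  avoid′ (outside n≤i) _ (inside k) i<j j<k p q =
    <⇒≱ (<-trans i<j (<-trans j<k (toℕ<n k))) n≤i
  avoid′ _ (outside n≤j) (inside k) i<j j<k p q = <⇒≱ (<-trans j<k (toℕ<n k)) n≤j

word : ∀ {n f} → Good n f → Word n
word g = tabulate λ i → fromℕ< (bounded g (toℕ<n i))

module _ {n f} (g : Good n f) where

  toℕ-word : ∀ i → toℕ (lookup (word g) i) ≡ f (toℕ i)
  toℕ-word i = trans (cong toℕ (lookup∘tabulate _ i)) (toℕ-fromℕ< _)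

  word-cube : Cube (word g)
  word-cube i = toℕ-injective (trans (toℕ-word _) (trans (cong f (toℕ-word _))
    (trans (cong (f ∘ f) (toℕ-word i)) (cube g _))))

  word-avoids : Avoids231 (word g)
  word-avoids {i} {j} {k} i<j j<k p q = avoid g i<j j<k
    (subst₂ _<_ (toℕ-word k) (toℕ-word i) p) (subst₂ _<_ (toℕ-word i) (toℕ-word j) q)

  word-extend : ∀ {π} → f ≗ extend π → word g ≡ π
  word-extend {π} eq = word-ext λ i → toℕ-injective
    (trans (toℕ-word i) (trans (eq _) (extend-inside π i)))

word-injective : ∀ {n f h} (g : Good n f) (g′ : Good n h) → word g ≡ word g′ → f ≗ h
word-injective {n} {f} {h} g g′ eq x with finView n x
... | inside i    = trans (sym (toℕ-word g i)) (trans (cong (λ π → toℕ (lookup π i)) eq) (toℕ-word g′ i))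
... | outside n≤x = trans (fixed g x n≤x) (sym (fixed g′ x n≤x))

codeWord : ∀ {n} → Code n → Word n
codeWord c = word (⟦⟧-good c)

codeWord-injective : ∀ {n} → Injective _≡_ _≡_ (codeWord {n})
codeWord-injective {x = c} {d} eq = ⟦⟧-injective c d (word-injective (⟦⟧-good c) (⟦⟧-good d) eq)

codeWord-complete : ∀ {n} (π : Word n) → Cube π → Avoids231 π → ∃ λ c → codeWord c ≡ π
codeWord-complete {n} π cb av = let c , eq = encode n (extend-good π cb av) in
  c , word-extend (⟦⟧-good c) eq

-- Inversion exchanges 231 and 312

-- For cube 1 this is the inverse.
square : ∀ {n} → Word n → Word n
square π = π ⊚ π

module _ {n} (π : Word n) (cb : Cube π) where

  private
    lookup-square : ∀ i → lookup (square π) i ≡ lookup π (lookup π i)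
    lookup-square = lookup∘tabulate _

    lookup-lookup-square : ∀ i → lookup π (lookup (square π) i) ≡ i
    lookup-lookup-square i = trans (cong (lookup π) (lookup-square i)) (cb i)

    via-square : ∀ {i j} → i Fin.< j →
      lookup π (lookup (square π) i) Fin.< lookup π (lookup (square π) j)
    via-square {i} {j} =
      subst₂ Fin._<_ (sym (lookup-lookup-square i)) (sym (lookup-lookup-square j))

  cube-injective : IsPerm π
  cube-injective {i} {j} eq = trans (sym (cb i)) (trans (cong (lookup π ∘ lookup π) eq) (cb j))

  square-square : square (square π) ≡ π
  square-square = word-ext λ i → trans (lookup∘tabulate _ i) (trans (lookup-square _)
    (cong (lookup π) (lookup-lookup-square i)))

  square-cube : Cube (square π)
  square-cube i = cube-injective (trans (lookup-lookup-square _)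
    (cube-injective (trans (cong (lookup π) (lookup-square _)) (trans (cb _) (lookup-square i)))))

  -- Inversion exchanges places and values: the values of an occurrence, in increasing order, are
  -- places where π takes the values k, i, j, a 312.
  square-avoids231 : Avoids312 π → Avoids231 (square π)
  square-avoids231 av i<j j<k p q = av p q (via-square i<j) (via-square j<k)

  square-avoids312 : Avoids231 π → Avoids312 (square π)
  square-avoids312 av i<j j<k p q = av p q (via-square i<j) (via-square j<k)

-- Order 1 or 3 versus cube 1

module _ {n} (π : Word n) where

  lookup-^1 : ∀ i → lookup (π ^ᵖ 1) i ≡ lookup π i
  lookup-^1 i = trans (lookup∘tabulate _ i) (cong (lookup π) (lookup-allFin i))

  lookup-^2 : ∀ i → lookup (π ^ᵖ 2) i ≡ lookup π (lookup π i)
  lookup-^2 i = trans (lookup∘tabulate _ i) (cong (lookup π) (lookup-^1 i))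

  lookup-^3 : ∀ i → lookup (π ^ᵖ 3) i ≡ lookup π (lookup π (lookup π i))
  lookup-^3 i = trans (lookup∘tabulate _ i) (cong (lookup π) (lookup-^2 i))

  order⇒cube : HasOrder π 1 ⊎ HasOrder π 3 → Cube π
  order⇒cube (inj₁ (_ , π≡1 , _)) i = trans (cong (lookup π ∘ lookup π) (π-id i))
    (trans (cong (lookup π) (π-id i)) (π-id i))
    where
    π-id : ∀ i → lookup π i ≡ i
    π-id i = trans (sym (lookup-^1 i)) (trans (cong (λ ρ → lookup ρ i) π≡1) (lookup-allFin i))
  order⇒cube (inj₂ (_ , π³≡1 , _)) i =
    trans (sym (lookup-^3 i)) (trans (cong (λ ρ → lookup ρ i) π³≡1) (lookup-allFin i))

  cube⇒order : Cube π → HasOrder π 1 ⊎ HasOrder π 3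
  cube⇒order cb with ≡-dec Fin._≟_ (π ^ᵖ 1) (idPerm n)
  ... | yes π≡1 = inj₁ (≤-refl , π≡1 , λ j 1≤j j<1 → contradiction 1≤j (<⇒≱ j<1))
  ... | no  π≢1 = inj₂
    (s≤s z≤n , word-ext (λ i → trans (lookup-^3 i) (trans (cb i) (sym (lookup-allFin i)))) , minimal)
    where
    minimal : ∀ j → 1 ≤ j → j < 3 → (π ^ᵖ j) ≢ idPerm n
    minimal 1 _ _ = π≢1
    -- Evaluating the square at `lookup π i` gives π³(i) = π(i), while the cube gives i.
    minimal 2 _ _ π²≡1 = π≢1 (word-ext λ i → trans (lookup-^1 i) (trans
      (sym (trans (sym (lookup-^2 _)) (trans (cong (λ ρ → lookup ρ (lookup π i)) π²≡1) (lookup-allFin _))))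
      (trans (cb i) (sym (lookup-allFin i)))))
    minimal (suc (suc (suc _))) _ (s≤s (s≤s (s≤s ())))

-- Occurrences of the two patterns

increasing₃ : ∀ {n} {a b c : Fin n} → a Fin.< b → b Fin.< c →
  StrictlyIncreasing (lookup (a ∷ b ∷ c ∷ []))
increasing₃ a<b b<c 0F 1F _ = a<b
increasing₃ a<b b<c 0F 2F _ = <-trans a<b b<c
increasing₃ a<b b<c 1F 2F _ = b<c
increasing₃ a<b b<c 1F 1F (s≤s ())
increasing₃ a<b b<c 2F 1F (s≤s ())
increasing₃ a<b b<c 2F 2F (s≤s (s≤s ()))

increasing-cancel : ∀ {m n} {ι : Fin m → Fin n} → StrictlyIncreasing ι →
  ∀ {j l} → ι j Fin.< ι l → j Fin.< l
increasing-cancel {ι = ι} inc {j} {l} ιj<ιl with Finₚ.<-cmp j l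
... | tri< j<l _ _  = j<l
... | tri≈ _ refl _ = contradiction ιj<ιl (<-irrefl refl)
... | tri> _ _ l<j  = contradiction (inc l j l<j) (<-asym ιj<ιl)

-- ι gives the places of the occurrence, v its values in increasing order.
occurs : ∀ {m n} (τ : Word m) (π : Word n) {ι v : Fin m → Fin n} →
  StrictlyIncreasing ι → StrictlyIncreasing v →
  (∀ j → lookup π (ι j) ≡ v (lookup τ j)) → Occurs τ π
occurs τ π {ι} incι incv eq = ι , incι , λ j l → mk⇔
  (increasing-cancel incv ∘ subst₂ Fin._<_ (eq j) (eq l))
  (subst₂ Fin._<_ (sym (eq j)) (sym (eq l)) ∘ incv (lookup τ j) (lookup τ l))

module _ {n} (π : Word n) where

  avoids231⁺ : Avoids231 π → Avoids π p231
  avoids231⁺ av (ι , inc , iff) = av (inc 0F 1F z<s) (inc 1F 2F (s<s z<s))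
    (Equivalence.from (iff 2F 0F) z<s) (Equivalence.from (iff 0F 1F) (s<s z<s))

  avoids231⁻ : Avoids π p231 → Avoids231 π
  avoids231⁻ av i<j j<k p q = av (occurs p231 π (increasing₃ i<j j<k) (increasing₃ p q)
    λ { 0F → refl ; 1F → refl ; 2F → refl })

  avoids312⁺ : Avoids312 π → Avoids π p312
  avoids312⁺ av (ι , inc , iff) = av (inc 0F 1F z<s) (inc 1F 2F (s<s z<s))
    (Equivalence.from (iff 1F 2F) z<s) (Equivalence.from (iff 2F 0F) (s<s z<s))

  avoids312⁻ : Avoids π p312 → Avoids312 π
  avoids312⁻ av i<j j<k p q = av (occurs p312 π (increasing₃ i<j j<k) (increasing₃ p q)
    λ { 0F → refl ; 1F → refl ; 2F → refl })

-- The two counts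

cube⇒InΩ13 : ∀ {m n} (τ : Word m) (π : Word n) → Cube π → Avoids π τ → InΩ13 τ n π
cube⇒InΩ13 τ π cb av = cube-injective π cb , av , cube⇒order π cb

card-231 : ∀ n → HasCard (InΩ13 p231 n) (length (codes n))
card-231 n = hasCard-codes codeWord codeWord-injective sound
  (λ π (_ , av , ord) → codeWord-complete π (order⇒cube π ord) (avoids231⁻ π av))
  where
  sound : ∀ c → InΩ13 p231 n (codeWord c)
  sound c = cube⇒InΩ13 p231 π (word-cube (⟦⟧-good c)) (avoids231⁺ π (word-avoids (⟦⟧-good c)))
    where π = codeWord c

-- `square` is an involution on words of cube 1, which gives both injectivity and completeness from
-- the case of 231.
card-312 : ∀ n → HasCard (InΩ13 p312 n) (length (codes n))
card-312 n = hasCard-codes (square ∘ codeWord) injective′ sound complete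
  where
  injective′ : Injective _≡_ _≡_ (square ∘ codeWord {n})
  injective′ {c} {d} eq = codeWord-injective
    (trans (sym (square-square (codeWord c) (word-cube (⟦⟧-good c))))
    (trans (cong square eq) (square-square (codeWord d) (word-cube (⟦⟧-good d)))))
  sound : ∀ c → InΩ13 p312 n (square (codeWord c))
  sound c = cube⇒InΩ13 p312 (square π) (square-cube π cb)
      (avoids312⁺ (square π) (square-avoids312 π cb (word-avoids (⟦⟧-good c))))
    where
    π  = codeWord c
    cb = word-cube (⟦⟧-good c)
  complete : ∀ π → InΩ13 p312 n π → ∃ λ c → square (codeWord c) ≡ π
  complete π (_ , av , ord) =
    let cb     = order⇒cube π ord
        c , eq = codeWord-complete (square π) (square-cube π cb)
                   (square-avoids231 π cb (avoids312⁻ π av))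
    in c , trans (cong square eq) (square-square π cb)

theorem1p2 : CountGF p231 × CountGF p312
theorem1p2 = (count , (λ n → card-231 (suc n)) , count-gf)
           , (count , (λ n → card-312 (suc n)) , count-gf)
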